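{- Let $n, k, \ell$ be positive integers with $n \geq k\ell$, $\ell \geq 2$, and $k \geq 3$. If $\mathcal{P}$ is an intersecting family of $(k,\ell)$-subpartitions of $[n]$, then $$|\mathcal{P}| \leq \frac{1}{(\ell-1)!} \prod_{i=1}^{\ell-1}\binom{n-ik}{k}.$$ Moreover, this bound is attained only by a canonical intersecting family of $(k,\ell)$-subpartitions, i.e. a family consisting of all $(k,\ell)$-subpartitions of $[n]$ that contain a fixed $k$-subset of $[n]$ as one of their classes.
   Context: Let $[n]=\{1,\dots,n\}$. A $(k,\ell)$-subpartition of $[n]$ is a set $P=\{P_1,\dots,P_\ell\}$ of $\ell$ pairwise disjoint $k$-subsets of $[n]$ (called classes); thus $|\bigcup_i P_i| = k\ell$. Two $(k,\ell)$-subpartitions $P=\{P_1,\dots,P_\ell\}$ and $Q=\{Q_1,\dots,Q_\ell\}$ are intersecting if $P_i=Q_j$ for some $i,j$, i.e. they have a common class. A family is intersecting if every two of its members are intersecting. -}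

module Defs where

open import Data.Nat using (ℕ; zero; suc; _*_; _∸_; _!)
open import Data.Nat.Combinatorics using (_C_)
open import Data.Fin.Subset using (Subset; ∣_∣; _∩_; Empty)
open import Data.List using (List; length)
open import Data.List.Membership.Propositional using (_∈_)
open import Data.List.Relation.Unary.All using (All)
open import Data.List.Relation.Unary.AllPairs using (AllPairs)
open import Data.Product using (_×_; ∃)
open import Relation.Binary.PropositionalEquality using (_≡_)
open import Relation.Nullary using (¬_)

Disjoint : ∀ {n} → Subset n → Subset n → Set
Disjoint p q = Empty (p ∩ q)

-- A (k,ℓ)-subpartition of [n]: ℓ pairwise disjoint k-subsets of [n].
-- Represented by a list of its classes; two such lists represent the same
-- subpartition iff they have the same classes (see SameClasses).
record SubPartition (n k ℓ : ℕ) : Set where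
  field
    classes : List (Subset n)
    len     : length classes ≡ ℓ
    sizes   : All (λ c → ∣ c ∣ ≡ k) classes
    disj    : AllPairs Disjoint classes
open SubPartition public

SameClasses : ∀ {n k ℓ} → SubPartition n k ℓ → SubPartition n k ℓ → Set
SameClasses P Q = (∀ c → c ∈ classes P → c ∈ classes Q)
                × (∀ c → c ∈ classes Q → c ∈ classes P)

Intersecting : ∀ {n k ℓ} → SubPartition n k ℓ → SubPartition n k ℓ → Set
Intersecting P Q = ∃ λ c → c ∈ classes P × c ∈ classes Q

-- A family of subpartitions: a list with no two members equal (as subpartitions);
-- its cardinality is the length of the list.
Distinct : ∀ {n k ℓ} → List (SubPartition n k ℓ) → Set
Distinct F = AllPairs (λ P Q → ¬ SameClasses P Q) F

IntersectingFamily : ∀ {n k ℓ} → List (SubPartition n k ℓ) → Set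
IntersectingFamily F = ∀ P Q → P ∈ F → Q ∈ F → Intersecting P Q

prodBinom : ℕ → ℕ → ℕ → ℕ
prodBinom n k zero    = 1
prodBinom n k (suc m) = prodBinom n k m * ((n ∸ suc m * k) C k)

{-# OPTIONS --safe #-}

-- Call a family a star if its members share a class.  Double counting pairs
-- (P , A) with A a further class of P bounds the number of subpartitions that
-- contain j prescribed classes by  ∏_{j ≤ i < ℓ} C(n - ik, k) / (ℓ - j)!.  For
-- j = 1 this is the bound for stars; a star attaining it cannot be enlarged,
-- hence is canonical.
--
-- In an intersecting family that is not a star fix P₀.  Every member contains
-- one of the ℓ classes A of P₀, and, if Q is a member without A, every member
-- containing A also contains one of the ℓ classes of Q.  So the family has at
-- most ℓ² times as many members as there are subpartitions through two given
-- classes, which is strictly below the bound because (ℓ - 1)ℓ² < C(n - k, k): as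
-- C(mk, k) increases with k and n - k ≥ (ℓ - 1)k, it suffices to check this for
-- k = 3 and n = 3ℓ.  The inequality may fail for ℓ = 2 and small n, but there a
-- family that is not a star contains three subpartitions on three pairwise
-- disjoint classes, so n ≥ 3k.

module Submission where

open import Defs

open import Algebra.Properties.CommutativeSemigroup using (x∙yz≈y∙xz)
open import Data.Bool using (true; false)
import Data.Bool.Properties as Bool
open import Data.Fin using (zero; suc)
open import Data.Fin.Subset using (Subset; ∣_∣; _∪_; ⋃; ⊥; inside; outside; Nonempty)
  renaming (_∈_ to _∈ₛ_)
open import Data.Fin.Subset.Properties
  using (x∈p∩q⁺; x∈p∩q⁻; x∈p∪q⁺; x∈p∪q⁻; ∉⊥; ∣⊥∣≡0; ∣p∣≤n; drop-∷-Empty)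
open import Data.List using (List; []; _∷_; [_]; _++_; length; filter; map)
import Data.List.Membership.DecPropositional as DecMembership
open import Data.List.Membership.Propositional using (_∈_; _∉_; find; lose)
open import Data.List.Membership.Propositional.Properties
  using (∈-++⁺ˡ; ∈-++⁺ʳ; ∈-++⁻; ∈-∃++; ∈-map⁺; ∈-filter⁺; ∈-AllPairs₂)
open import Data.List.Properties using (length-map; length-++; length-++-sucʳ; filter-some)
import Data.List.Relation.Binary.Subset.DecPropositional as DecSubset
open import Data.List.Relation.Binary.Subset.Propositional using (_⊆_)
open import Data.List.Relation.Unary.All as All using (All; []; _∷_)
import Data.List.Relation.Unary.All.Properties as All
open import Data.List.Relation.Unary.AllPairs as AllPairs using (AllPairs; []; _∷_)
import Data.List.Relation.Unary.AllPairs.Properties as AllPairs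
open import Data.List.Relation.Unary.Any as Any using (Any; here; there)
open import Data.List.Relation.Unary.Unique.Propositional using (Unique)
open import Data.Nat
  using ( ℕ; zero; suc; _+_; _*_; _∸_; _!; _≤_; _<_; z≤n; s≤s; _≤′_; ≤′-refl; ≤′-step
        ; NonZero; >-nonZero; >-nonZero⁻¹)
open import Data.Nat.Combinatorics using (_C_; nCn≡1; nC1≡n; nCk+nC[k+1]≡[n+1]C[k+1])
open import Data.Nat.ListAction using (sum)
open import Data.Nat.Properties
open import Data.Nat.Tactic.RingSolver using (solve-∀)
open import Data.Product as Product using (_×_; _,_; proj₂; ∃)
open import Data.Sum using (_⊎_; inj₁; inj₂; [_,_]′)
open import Data.Vec using ([]; _∷_; here; there)
import Data.Vec.Properties as Vec
open import Function using (_∘_; flip)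
open import Function.Bundles using (_⇔_; mk⇔)
open import Relation.Binary.Core using (Rel; REL)
open import Relation.Binary.Definitions using (Decidable; DecidableEquality; Symmetric)
open import Relation.Binary.PropositionalEquality
  using (_≡_; _≢_; refl; sym; trans; cong; cong₂; subst; module ≡-Reasoning)
open import Relation.Nullary using (Dec; yes; no; does; contradiction)
open import Relation.Nullary.Decidable using (map′; _×-dec_)

private
  variable
    n k ℓ : ℕ

-- Binomial coefficients

C-absorption : ∀ n k → suc k * (suc n C suc k) ≡ suc n * (n C k)
C-absorption n       zero    = trans (*-identityˡ _) (trans (nC1≡n (suc n)) (sym (*-identityʳ _)))
C-absorption zero    (suc k) = *-zeroʳ (2 + k)
C-absorption (suc n) (suc k) = begin
  (2 + k) * ((2 + n) C (2 + k))
    ≡⟨ cong ((2 + k) *_) (nCk+nC[k+1]≡[n+1]C[k+1] (suc n) (suc k)) ⟨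
  (2 + k) * (x + suc n C (2 + k))
    ≡⟨ *-distribˡ-+ (2 + k) x _ ⟩
  (x + suc k * x) + (2 + k) * (suc n C (2 + k))
    ≡⟨ cong₂ (λ u v → (x + u) + v) (C-absorption n k) (C-absorption n (suc k)) ⟩
  (x + suc n * (n C k)) + suc n * (n C suc k)
    ≡⟨ +-assoc x _ _ ⟩
  x + (suc n * (n C k) + suc n * (n C suc k))
    ≡⟨ cong (x +_) (*-distribˡ-+ (suc n) (n C k) _) ⟨
  x + suc n * (n C k + n C suc k)
    ≡⟨ cong (λ u → x + suc n * u) (nCk+nC[k+1]≡[n+1]C[k+1] n k) ⟩
  (2 + n) * x ∎
  where
  open ≡-Reasoning
  x : ℕ
  x = suc n C suc k

6*[3+n]C3 : ∀ n → 6 * ((3 + n) C 3) ≡ (3 + n) * ((2 + n) * (1 + n))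
6*[3+n]C3 n = begin
  6 * ((3 + n) C 3)                    ≡⟨ *-assoc 2 3 ((3 + n) C 3) ⟩
  2 * (3 * ((3 + n) C 3))              ≡⟨ cong (2 *_) (C-absorption (2 + n) 2) ⟩
  2 * ((3 + n) * ((2 + n) C 2))        ≡⟨ x∙yz≈y∙xz *-commutativeSemigroup 2 (3 + n) ((2 + n) C 2) ⟩
  (3 + n) * (2 * ((2 + n) C 2))        ≡⟨ cong ((3 + n) *_) (C-absorption (1 + n) 1) ⟩
  (3 + n) * ((2 + n) * ((1 + n) C 1))  ≡⟨ cong (λ x → (3 + n) * ((2 + n) * x)) (nC1≡n (1 + n)) ⟩
  (3 + n) * ((2 + n) * (1 + n))        ∎
  where open ≡-Reasoning

nCk≤[n+1]Ck : ∀ n k → n C k ≤ suc n C k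
nCk≤[n+1]Ck n zero    = ≤-refl
nCk≤[n+1]Ck n (suc k) = ≤-trans (m≤n+m _ (n C k)) (≤-reflexive (nCk+nC[k+1]≡[n+1]C[k+1] n k))

nCk≤[n+1]C[k+1] : ∀ n k → n C k ≤ suc n C suc k
nCk≤[n+1]C[k+1] n k = ≤-trans (m≤m+n (n C k) _) (≤-reflexive (nCk+nC[k+1]≡[n+1]C[k+1] n k))

C-monoˡ-≤ : ∀ k {m n} → m ≤ n → m C k ≤ n C k
C-monoˡ-≤ k = mono ∘ ≤⇒≤′
  where
  mono : ∀ {m n} → m ≤′ n → m C k ≤ n C k
  mono ≤′-refl                    = ≤-refl
  mono {n = suc n} (≤′-step m≤′n) = ≤-trans (mono m≤′n) (nCk≤[n+1]Ck n k)

k≤n⇒0<nCk : ∀ {n k} → k ≤ n → 0 < n C k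
k≤n⇒0<nCk {k = k} k≤n = ≤-trans (≤-reflexive (sym (nCn≡1 k))) (C-monoˡ-≤ k k≤n)

[k*m]Ck-mono-≤ : ∀ m .{{_ : NonZero m}} {j k} → j ≤ k → (j * m) C j ≤ (k * m) C k
[k*m]Ck-mono-≤ m = mono ∘ ≤⇒≤′
  where
  open ≤-Reasoning
  mono : ∀ {j k} → j ≤′ k → (j * m) C j ≤ (k * m) C k
  mono ≤′-refl = ≤-refl
  mono {j} {suc k} (≤′-step j≤′k) = begin
    (j * m) C j          ≤⟨ mono j≤′k ⟩
    (k * m) C k          ≤⟨ nCk≤[n+1]C[k+1] (k * m) k ⟩
    suc (k * m) C suc k  ≤⟨ C-monoˡ-≤ (suc k) (+-monoˡ-≤ (k * m) (>-nonZero⁻¹ m)) ⟩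
    (suc k * m) C suc k  ∎

m*[1+m]²<[3*m]C3 : ∀ {m} → 2 ≤ m → m * ((1 + m) * (1 + m)) < (3 * m) C 3
m*[1+m]²<[3*m]C3 (s≤s (s≤s {n = q} _)) = *-cancelˡ-< 6 _ _ (begin-strict
  6 * ((2 + q) * ((3 + q) * (3 + q)))
    <⟨ m<m+n _ (s≤s z≤n) ⟩
  6 * ((2 + q) * ((3 + q) * (3 + q))) + 3 * (2 + q) * (2 + 15 * q + 7 * (q * q))
    ≡⟨ expand q ⟩
  (6 + 3 * q) * ((5 + 3 * q) * (4 + 3 * q))
    ≡⟨ 6*[3+n]C3 (3 + 3 * q) ⟨
  6 * ((6 + 3 * q) C 3)
    ≡⟨ cong (λ x → 6 * (x C 3)) (*-distribˡ-+ 3 2 q) ⟨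
  6 * ((3 * (2 + q)) C 3) ∎)
  where
  open ≤-Reasoning
  expand : ∀ q → 6 * ((2 + q) * ((3 + q) * (3 + q))) + 3 * (2 + q) * (2 + 15 * q + 7 * (q * q))
         ≡ (6 + 3 * q) * ((5 + 3 * q) * (4 + 3 * q))
  expand = solve-∀

m*[1+m]²<nCk : ∀ {m n k} → 2 ≤ m → 3 ≤ k → k * m ≤ n → m * ((1 + m) * (1 + m)) < n C k
m*[1+m]²<nCk {m@(suc _)} {n} {k} 2≤m 3≤k km≤n = begin-strict
  m * ((1 + m) * (1 + m))  <⟨ m*[1+m]²<[3*m]C3 2≤m ⟩
  (3 * m) C 3              ≤⟨ [k*m]Ck-mono-≤ m 3≤k ⟩
  (k * m) C k              ≤⟨ C-monoˡ-≤ k km≤n ⟩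
  n C k                    ∎
  where open ≤-Reasoning

-- Finite lists

module _ {a} {A : Set a} where

  unique-⊆⇒length≤ : {xs ys : List A} → Unique xs → xs ⊆ ys → length xs ≤ length ys
  unique-⊆⇒length≤ {[]}     _             _       = z≤n
  unique-⊆⇒length≤ {x ∷ xs} (x∉xs ∷ xs!) xs⊆ys with ∈-∃++ (xs⊆ys (here refl))
  ... | us , vs , refl =
    ≤-trans (s≤s (unique-⊆⇒length≤ xs! xs⊆us++vs)) (≤-reflexive (sym (length-++-sucʳ us x vs)))
    where
    xs⊆us++vs : xs ⊆ us ++ vs
    xs⊆us++vs y∈xs with ∈-++⁻ us (xs⊆ys (there y∈xs))
    ... | inj₁ y∈us         = ∈-++⁺ˡ y∈us
    ... | inj₂ (here refl)  = contradiction refl (All.lookup x∉xs y∈xs)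
    ... | inj₂ (there y∈vs) = ∈-++⁺ʳ us y∈vs

  unique-⊆-length≥⇒⊇ : DecidableEquality A → {xs ys : List A} →
    Unique xs → xs ⊆ ys → length ys ≤ length xs → ys ⊆ xs
  unique-⊆-length≥⇒⊇ _≟_ {xs} xs! xs⊆ys ∣ys∣≤∣xs∣ {y} y∈ys with y ∈? xs
    where open DecMembership _≟_ using (_∈?_)
  ... | yes y∈xs = y∈xs
  ... | no  y∉xs =
    contradiction (unique-⊆⇒length≤ (All.¬Any⇒All¬ xs y∉xs ∷ xs!) y∷xs⊆ys) (≤⇒≯ ∣ys∣≤∣xs∣)
    where
    y∷xs⊆ys : y ∷ xs ⊆ _
    y∷xs⊆ys (here refl)  = y∈ys
    y∷xs⊆ys (there x∈xs) = xs⊆ys x∈xs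

  module _ {r} {R : Rel A r} (R-sym : Symmetric R) where

    AllPairs-lookup₂ : ∀ {xs x y} → AllPairs R xs → x ∈ xs → y ∈ xs → x ≢ y → R x y
    AllPairs-lookup₂ Rxs x∈xs y∈xs x≢y with ∈-AllPairs₂ Rxs x∈xs y∈xs
    ... | inj₁ x≡y        = contradiction x≡y x≢y
    ... | inj₂ (inj₁ Rxy) = Rxy
    ... | inj₂ (inj₂ Ryx) = R-sym Ryx

    AllPairs-⊆ : ∀ {xs ys} → Unique xs → xs ⊆ ys → AllPairs R ys → AllPairs R xs
    AllPairs-⊆ []           _     _   = []
    AllPairs-⊆ (x∉xs ∷ xs!) xs⊆ys Rys =
      All.tabulate (λ z∈xs → AllPairs-lookup₂ Rys (xs⊆ys (here refl)) (xs⊆ys (there z∈xs))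
                                              (All.lookup x∉xs z∈xs))
      ∷ AllPairs-⊆ xs! (xs⊆ys ∘ there) Rys

length*≤sum : ∀ {m ns} → All (m ≤_) ns → length ns * m ≤ sum ns
length*≤sum []           = z≤n
length*≤sum (m≤n ∷ m≤ns) = +-mono-≤ m≤n (length*≤sum m≤ns)

*sum≤length* : ∀ c {b ns} → All (λ n → c * n ≤ b) ns → c * sum ns ≤ length ns * b
*sum≤length* c []                           = ≤-reflexive (*-zeroʳ c)
*sum≤length* c {ns = n ∷ ns} (cn≤b ∷ cns≤b) =
  ≤-trans (≤-reflexive (*-distribˡ-+ c n (sum ns))) (+-mono-≤ cn≤b (*sum≤length* c cns≤b))

module _ {a b r} {A : Set a} {B : Set b} {R : REL A B r} (R? : Decidable R) where

  degree : List B → A → ℕ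
  degree ys x = length (filter (R? x) ys)

  incidences : List A → List B → ℕ
  incidences xs ys = sum (map (degree ys) xs)

module _ {a b r} {A : Set a} {B : Set b} {R : REL A B r} (R? : Decidable R) where

  incidences-[]ʳ : ∀ xs → incidences R? xs [] ≡ 0
  incidences-[]ʳ []       = refl
  incidences-[]ʳ (x ∷ xs) = incidences-[]ʳ xs

  incidences-∷ʳ : ∀ xs y ys →
    incidences R? xs (y ∷ ys) ≡ degree (flip R?) xs y + incidences R? xs ys
  incidences-∷ʳ []       y ys = refl
  incidences-∷ʳ (x ∷ xs) y ys
    with does (R? x y)
       | trans (cong (degree R? ys x +_) (incidences-∷ʳ xs y ys))
               (x∙yz≈y∙xz +-commutativeSemigroup (degree R? ys x) (degree (flip R?) xs y) _)
  ... | true  | regrouped = cong suc regrouped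
  ... | false | regrouped = regrouped

  incidences-flip : ∀ xs ys → incidences R? xs ys ≡ incidences (flip R?) ys xs
  incidences-flip xs []       = incidences-[]ʳ xs
  incidences-flip xs (y ∷ ys) =
    trans (incidences-∷ʳ xs y ys) (cong (degree (flip R?) xs y +_) (incidences-flip xs ys))

  double-counting : ∀ c {m b xs ys} →
    All (λ x → m ≤ degree R? ys x) xs → All (λ y → c * degree (flip R?) xs y ≤ b) ys →
    c * (length xs * m) ≤ length ys * b
  double-counting c {m} {b} {xs} {ys} m≤degrees c*degrees≤b = begin
    c * (length xs * m)
      ≡⟨ cong (λ l → c * (l * m)) (length-map (degree R? ys) xs) ⟨
    c * (length (map (degree R? ys) xs) * m)
      ≤⟨ *-monoʳ-≤ c (length*≤sum (All.map⁺ m≤degrees)) ⟩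
    c * incidences R? xs ys
      ≡⟨ cong (c *_) (incidences-flip xs ys) ⟩
    c * incidences (flip R?) ys xs
      ≤⟨ *sum≤length* c (All.map⁺ c*degrees≤b) ⟩
    length (map (degree (flip R?) xs) ys) * b
      ≡⟨ cong (_* b) (length-map (degree (flip R?) xs) ys) ⟩
    length ys * b ∎
    where open ≤-Reasoning

  covering-bound : ∀ c {b xs ys} →
    All (λ x → Any (R x) ys) xs → All (λ y → c * degree (flip R?) xs y ≤ b) ys →
    c * length xs ≤ length ys * b
  covering-bound c {b} {xs} {ys} covered c*degrees≤b =
    subst (λ l → c * l ≤ length ys * b) (*-identityʳ (length xs))
      (double-counting c (All.map (filter-some (R? _)) covered) c*degrees≤b)

-- Subsets of [n]

_≟ₛ_ : DecidableEquality (Subset n)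
_≟ₛ_ = Vec.≡-dec Bool._≟_

module _ {n : ℕ} where
  open DecMembership (_≟ₛ_ {n}) public using (_∈?_)
  open DecSubset (_≟ₛ_ {n}) public using (_⊆?_)

x∈⋃⁺ : ∀ {x} {ps : List (Subset n)} → Any (x ∈ₛ_) ps → x ∈ₛ ⋃ ps
x∈⋃⁺ (here x∈p)   = x∈p∪q⁺ (inj₁ x∈p)
x∈⋃⁺ (there x∈ps) = x∈p∪q⁺ (inj₂ (x∈⋃⁺ x∈ps))

x∈⋃⁻ : ∀ {x} (ps : List (Subset n)) → x ∈ₛ ⋃ ps → Any (x ∈ₛ_) ps
x∈⋃⁻ []       x∈⊥   = contradiction x∈⊥ ∉⊥
x∈⋃⁻ (p ∷ ps) x∈p∪⋃ = [ here , there ∘ x∈⋃⁻ ps ]′ (x∈p∪q⁻ p (⋃ ps) x∈p∪⋃)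

size⇒Nonempty : .{{_ : NonZero k}} {p : Subset n} → ∣ p ∣ ≡ k → Nonempty p
size⇒Nonempty {suc k} {p = inside  ∷ p} _     = zero , here
size⇒Nonempty {suc k} {p = outside ∷ p} ∣p∣≡k = Product.map suc there (size⇒Nonempty ∣p∣≡k)

Disjoint-sym : Symmetric (Disjoint {n})
Disjoint-sym {x = p} {q} p#q (x , x∈q∩p) =
  let x∈q , x∈p = x∈p∩q⁻ q p x∈q∩p in p#q (x , x∈p∩q⁺ (x∈p , x∈q))

outside-∷-disjoint : ∀ s {p q : Subset n} → Disjoint p q → Disjoint (outside ∷ p) (s ∷ q)
outside-∷-disjoint _ p#q (_ , there x∈) = p#q (_ , x∈)

disjoint-outside-∷ : ∀ s {p q : Subset n} → Disjoint p q → Disjoint (s ∷ p) (outside ∷ q)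
disjoint-outside-∷ inside  p#q (_ , there x∈) = p#q (_ , x∈)
disjoint-outside-∷ outside p#q (_ , there x∈) = p#q (_ , x∈)

disjoint⇒≢ : {p q : Subset n} → Nonempty p → Disjoint p q → p ≢ q
disjoint⇒≢ (x , x∈p) p#q refl = p#q (x , x∈p∩q⁺ (x∈p , x∈p))

disjoint⇒unique : {ps : List (Subset n)} → All Nonempty ps → AllPairs Disjoint ps → Unique ps
disjoint⇒unique []         []         = []
disjoint⇒unique (ne ∷ nes) (p# ∷ ps#) = All.map (disjoint⇒≢ ne) p# ∷ disjoint⇒unique nes ps#

disjoint-⋃⁺ : {p : Subset n} {qs : List (Subset n)} → All (Disjoint p) qs → Disjoint p (⋃ qs)
disjoint-⋃⁺ {p = p} {qs} p#qs (x , x∈p∩⋃) =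
  let x∈p , x∈⋃      = x∈p∩q⁻ p (⋃ qs) x∈p∩⋃
      q , q∈qs , x∈q = find (x∈⋃⁻ qs x∈⋃)
  in All.lookup p#qs q∈qs (x , x∈p∩q⁺ (x∈p , x∈q))

disjoint-⋃⇒∉ : {p : Subset n} {qs : List (Subset n)} → Nonempty p → Disjoint p (⋃ qs) → p ∉ qs
disjoint-⋃⇒∉ (x , x∈p) p#⋃ p∈qs = p#⋃ (x , x∈p∩q⁺ (x∈p , x∈⋃⁺ (lose p∈qs x∈p)))

disjoint-∣∪∣ : (p q : Subset n) → Disjoint p q → ∣ p ∪ q ∣ ≡ ∣ p ∣ + ∣ q ∣
disjoint-∣∪∣ []            []            _   = refl
disjoint-∣∪∣ (inside  ∷ p) (inside  ∷ q) p#q = contradiction (zero , here) p#q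
disjoint-∣∪∣ (inside  ∷ p) (outside ∷ q) p#q = cong suc (disjoint-∣∪∣ p q (drop-∷-Empty p#q))
disjoint-∣∪∣ (outside ∷ p) (inside  ∷ q) p#q =
  trans (cong suc (disjoint-∣∪∣ p q (drop-∷-Empty p#q))) (sym (+-suc ∣ p ∣ ∣ q ∣))
disjoint-∣∪∣ (outside ∷ p) (outside ∷ q) p#q = disjoint-∣∪∣ p q (drop-∷-Empty p#q)

disjoint-∣⋃∣ : {ps : List (Subset n)} → AllPairs Disjoint ps → All (λ p → ∣ p ∣ ≡ k) ps →
  ∣ ⋃ ps ∣ ≡ length ps * k
disjoint-∣⋃∣ {n = n}       []         []               = ∣⊥∣≡0 n
disjoint-∣⋃∣ {ps = p ∷ ps} (p# ∷ ps#) (∣p∣≡k ∷ ∣ps∣≡k) =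
  trans (disjoint-∣∪∣ p (⋃ ps) (disjoint-⋃⁺ p#)) (cong₂ _+_ ∣p∣≡k (disjoint-∣⋃∣ ps# ∣ps∣≡k))

disjoint⇒length*k≤n : {ps : List (Subset n)} → AllPairs Disjoint ps → All (λ p → ∣ p ∣ ≡ k) ps →
  length ps * k ≤ n
disjoint⇒length*k≤n {ps = ps} ps# ∣ps∣≡k = subst (_≤ _) (disjoint-∣⋃∣ ps# ∣ps∣≡k) (∣p∣≤n (⋃ ps))

subsetsAvoiding : Subset n → ℕ → List (Subset n)
subsetsAvoiding []            zero    = [ [] ]
subsetsAvoiding []            (suc k) = []
subsetsAvoiding (inside  ∷ u) k       = map (outside ∷_) (subsetsAvoiding u k)
subsetsAvoiding (outside ∷ u) zero    = map (outside ∷_) (subsetsAvoiding u zero)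
subsetsAvoiding (outside ∷ u) (suc k) =
  map (inside ∷_) (subsetsAvoiding u k) ++ map (outside ∷_) (subsetsAvoiding u (suc k))

length-subsetsAvoiding : (u : Subset n) (k : ℕ) → length (subsetsAvoiding u k) ≡ (n ∸ ∣ u ∣) C k
length-subsetsAvoiding []            zero    = refl
length-subsetsAvoiding []            (suc k) = refl
length-subsetsAvoiding (inside  ∷ u) k       =
  trans (length-map _ (subsetsAvoiding u k)) (length-subsetsAvoiding u k)
length-subsetsAvoiding (outside ∷ u) zero    =
  trans (length-map _ (subsetsAvoiding u zero)) (length-subsetsAvoiding u zero)
length-subsetsAvoiding {suc n} (outside ∷ u) (suc k) = begin
  length (map (inside ∷_) withHead ++ map (outside ∷_) withoutHead)
    ≡⟨ length-++ (map (inside ∷_) withHead) ⟩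
  length (map (inside ∷_) withHead) + length (map (outside ∷_) withoutHead)
    ≡⟨ cong₂ _+_ (length-map _ withHead) (length-map _ withoutHead) ⟩
  length withHead + length withoutHead
    ≡⟨ cong₂ _+_ (length-subsetsAvoiding u k) (length-subsetsAvoiding u (suc k)) ⟩
  (n ∸ ∣ u ∣) C k + (n ∸ ∣ u ∣) C suc k
    ≡⟨ nCk+nC[k+1]≡[n+1]C[k+1] (n ∸ ∣ u ∣) k ⟩
  suc (n ∸ ∣ u ∣) C suc k
    ≡⟨ cong (_C suc k) (+-∸-assoc 1 (∣p∣≤n u)) ⟨
  (suc n ∸ ∣ u ∣) C suc k ∎
  where
  open ≡-Reasoning
  withHead withoutHead : List (Subset n)
  withHead    = subsetsAvoiding u k
  withoutHead = subsetsAvoiding u (suc k)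

∈-subsetsAvoiding⁺ : (u : Subset n) {p : Subset n} → ∣ p ∣ ≡ k → Disjoint p u →
  p ∈ subsetsAvoiding u k
∈-subsetsAvoiding⁺ [] {[]} refl _ = here refl
∈-subsetsAvoiding⁺ (inside  ∷ u) {inside  ∷ p} _ p#u = contradiction (zero , here) p#u
∈-subsetsAvoiding⁺ (inside  ∷ u) {outside ∷ p} ∣p∣≡k p#u =
  ∈-map⁺ _ (∈-subsetsAvoiding⁺ u ∣p∣≡k (drop-∷-Empty p#u))
∈-subsetsAvoiding⁺ (outside ∷ u) {inside  ∷ p} refl p#u =
  ∈-++⁺ˡ (∈-map⁺ _ (∈-subsetsAvoiding⁺ u refl (drop-∷-Empty p#u)))
∈-subsetsAvoiding⁺ {k = zero}  (outside ∷ u) {outside ∷ p} ∣p∣≡k p#u =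
  ∈-map⁺ _ (∈-subsetsAvoiding⁺ u ∣p∣≡k (drop-∷-Empty p#u))
∈-subsetsAvoiding⁺ {k = suc k} (outside ∷ u) {outside ∷ p} ∣p∣≡k p#u =
  ∈-++⁺ʳ (map (inside ∷_) (subsetsAvoiding u k))
    (∈-map⁺ _ (∈-subsetsAvoiding⁺ u ∣p∣≡k (drop-∷-Empty p#u)))

all-subsetsAvoiding : (u : Subset n) (k : ℕ) →
  All (λ p → ∣ p ∣ ≡ k × Disjoint p u) (subsetsAvoiding u k)
all-subsetsAvoiding [] zero    = (refl , λ ()) ∷ []
all-subsetsAvoiding [] (suc k) = []
all-subsetsAvoiding (inside ∷ u) k =
  All.map⁺ (All.map (Product.map₂ (outside-∷-disjoint inside)) (all-subsetsAvoiding u k))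
all-subsetsAvoiding (outside ∷ u) zero =
  All.map⁺ (All.map (Product.map₂ (disjoint-outside-∷ outside)) (all-subsetsAvoiding u zero))
all-subsetsAvoiding (outside ∷ u) (suc k) = All.++⁺
  (All.map⁺ (All.map (Product.map (cong suc) (disjoint-outside-∷ inside)) (all-subsetsAvoiding u k)))
  (All.map⁺ (All.map (Product.map₂ (disjoint-outside-∷ outside)) (all-subsetsAvoiding u (suc k))))

-- Counting subpartitions through given classes

prodBinomFrom : ℕ → ℕ → ℕ → ℕ → ℕ
prodBinomFrom n k j zero    = 1
prodBinomFrom n k j (suc m) = ((n ∸ j * k) C k) * prodBinomFrom n k (suc j) m

prodBinomFrom-sucʳ : ∀ n k j m →
  prodBinomFrom n k j (suc m) ≡ prodBinomFrom n k j m * ((n ∸ (j + m) * k) C k)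
prodBinomFrom-sucʳ n k j zero    rewrite +-identityʳ j = *-comm ((n ∸ j * k) C k) 1
prodBinomFrom-sucʳ n k j (suc m) rewrite +-suc j m = begin
  first * prodBinomFrom n k (suc j) (suc m)     ≡⟨ cong (first *_) (prodBinomFrom-sucʳ n k (suc j) m) ⟩
  first * (prodBinomFrom n k (suc j) m * last)  ≡⟨ *-assoc first _ last ⟨
  first * prodBinomFrom n k (suc j) m * last    ∎
  where
  open ≡-Reasoning
  first last : ℕ
  first = (n ∸ j * k) C k
  last  = (n ∸ suc (j + m) * k) C k

prodBinom≡prodBinomFrom-1 : ∀ n k m → prodBinom n k m ≡ prodBinomFrom n k 1 m
prodBinom≡prodBinomFrom-1 n k zero    = refl
prodBinom≡prodBinomFrom-1 n k (suc m) = begin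
  prodBinom n k m * ((n ∸ suc m * k) C k)
    ≡⟨ cong (_* ((n ∸ suc m * k) C k)) (prodBinom≡prodBinomFrom-1 n k m) ⟩
  prodBinomFrom n k 1 m * ((n ∸ suc m * k) C k)
    ≡⟨ prodBinomFrom-sucʳ n k 1 m ⟨
  prodBinomFrom n k 1 (suc m) ∎
  where open ≡-Reasoning

k*[j+m]≤n⇒k*m≤n∸j*k : ∀ k j {m n} → k * (j + m) ≤ n → k * m ≤ n ∸ j * k
k*[j+m]≤n⇒k*m≤n∸j*k k j {m} k[j+m]≤n =
  m+n≤o⇒m≤o∸n (k * m) (≤-trans (≤-reflexive (regroup k m j)) k[j+m]≤n)
  where
  regroup : ∀ k m j → k * m + j * k ≡ k * (j + m)
  regroup = solve-∀

0<prodBinomFrom : ∀ j m → k * (j + m) ≤ n → 0 < prodBinomFrom n k j m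
0<prodBinomFrom                 j zero    _ = ≤-refl
0<prodBinomFrom {k = k} {n = n} j (suc m) k[j+1+m]≤n = *-mono-≤
  (k≤n⇒0<nCk (≤-trans (m≤m*n k (suc m)) (k*[j+m]≤n⇒k*m≤n∸j*k k j k[j+1+m]≤n)))
  (0<prodBinomFrom (suc j) m (subst (λ i → k * i ≤ n) (+-suc j m) k[j+1+m]≤n))

module _ (P : SubPartition n k ℓ) where

  class-size : ∀ {A} → A ∈ classes P → ∣ A ∣ ≡ k
  class-size = All.lookup (sizes P)

  class-disjoint : ∀ {A B} → A ∈ classes P → B ∈ classes P → A ≢ B → Disjoint A B
  class-disjoint = AllPairs-lookup₂ Disjoint-sym (disj P)

  ⊆classes⇒∣⋃∣ : ∀ {Cs} → Unique Cs → Cs ⊆ classes P → ∣ ⋃ Cs ∣ ≡ length Cs * k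
  ⊆classes⇒∣⋃∣ Cs! Cs⊆P =
    disjoint-∣⋃∣ (AllPairs-⊆ Disjoint-sym Cs! Cs⊆P (disj P)) (All.tabulate (class-size ∘ Cs⊆P))

  classes-unique : .{{_ : NonZero k}} → Unique (classes P)
  classes-unique = disjoint⇒unique (All.map size⇒Nonempty (sizes P)) (disj P)

_∋?_ : (P : SubPartition n k ℓ) (A : Subset n) → Dec (A ∈ classes P)
P ∋? A = A ∈? classes P

through : Subset n → List (SubPartition n k ℓ) → List (SubPartition n k ℓ)
through A = filter (_∋? A)

CommonClass : List (SubPartition n k ℓ) → Subset n → Set
CommonClass F A = All (λ P → A ∈ classes P) F

common⇒⊆classes : {F : List (SubPartition n k ℓ)} {Cs : List (Subset n)} {P : SubPartition n k ℓ} →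
  All (CommonClass F) Cs → P ∈ F → Cs ⊆ classes P
common⇒⊆classes common P∈F A∈Cs = All.lookup (All.lookup common A∈Cs) P∈F

through-common : ∀ A (F : List (SubPartition n k ℓ)) {Cs} → All (CommonClass F) Cs →
  All (CommonClass (through A F)) (A ∷ Cs)
through-common A F common = All.all-filter (_∋? A) F ∷ All.map (All.filter⁺ (_∋? A)) common

⊆classes⇒sameClasses : {Cs : List (Subset n)} → Unique Cs → length Cs ≡ ℓ →
  (P Q : SubPartition n k ℓ) → Cs ⊆ classes P → Cs ⊆ classes Q → SameClasses P Q
⊆classes⇒sameClasses {n = n} {ℓ = ℓ} {k = k} {Cs} Cs! ∣Cs∣≡ℓ P Q Cs⊆P Cs⊆Q =
  (λ _ → Cs⊆Q ∘ classes⊆Cs P Cs⊆P) , (λ _ → Cs⊆P ∘ classes⊆Cs Q Cs⊆Q)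
  where
  classes⊆Cs : (R : SubPartition n k ℓ) → Cs ⊆ classes R → classes R ⊆ Cs
  classes⊆Cs R Cs⊆R =
    unique-⊆-length≥⇒⊇ _≟ₛ_ Cs! Cs⊆R (≤-reflexive (trans (len R) (sym ∣Cs∣≡ℓ)))

all-classes-common⇒length≤1 : {Cs : List (Subset n)} → Unique Cs → length Cs ≡ ℓ →
  (F : List (SubPartition n k ℓ)) → Distinct F → All (CommonClass F) Cs → length F ≤ 1
all-classes-common⇒length≤1 _ _ []       _ _ = z≤n
all-classes-common⇒length≤1 _ _ (_ ∷ []) _ _ = ≤-refl
all-classes-common⇒length≤1 Cs! ∣Cs∣≡ℓ (P ∷ Q ∷ _) ((P≠Q ∷ _) ∷ _) common = contradiction
  (⊆classes⇒sameClasses Cs! ∣Cs∣≡ℓ P Q (common⇒⊆classes common (here refl))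
                                       (common⇒⊆classes common (there (here refl))))
  P≠Q

module _ .{{_ : NonZero k}} where

  ℓ≤length+degree : (P : SubPartition n k ℓ) (Cs : List (Subset n)) → Cs ⊆ classes P →
    ℓ ≤ length Cs + degree _∋?_ (subsetsAvoiding (⋃ Cs) k) P
  ℓ≤length+degree {n = n} {ℓ = ℓ} P Cs Cs⊆P = begin
    ℓ                                         ≡⟨ len P ⟨
    length (classes P)                        ≤⟨ unique-⊆⇒length≤ (classes-unique P) given⊎further ⟩
    length (Cs ++ filter (P ∋?_) candidates)  ≡⟨ length-++ Cs ⟩
    length Cs + degree _∋?_ candidates P      ∎
    where
    open ≤-Reasoning
    candidates : List (Subset n)
    candidates = subsetsAvoiding (⋃ Cs) k

    given⊎further : classes P ⊆ Cs ++ filter (P ∋?_) candidates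
    given⊎further {A} A∈P with A ∈? Cs
    ... | yes A∈Cs = ∈-++⁺ˡ A∈Cs
    ... | no  A∉Cs =
      ∈-++⁺ʳ Cs (∈-filter⁺ (P ∋?_) (∈-subsetsAvoiding⁺ (⋃ Cs) (class-size P A∈P) A#⋃Cs) A∈P)
      where
      A#⋃Cs : Disjoint A (⋃ Cs)
      A#⋃Cs = disjoint-⋃⁺ (All.tabulate λ B∈Cs →
        class-disjoint P A∈P (Cs⊆P B∈Cs) λ { refl → A∉Cs B∈Cs })

  commonClasses-bound : ∀ m (Cs : List (Subset n)) → length Cs + m ≡ ℓ → Unique Cs →
    (F : List (SubPartition n k ℓ)) → Distinct F → All (CommonClass F) Cs →
    m ! * length F ≤ prodBinomFrom n k (length Cs) m
  commonClasses-bound m    Cs _      _   [] _        _      =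
    ≤-trans (≤-reflexive (*-zeroʳ (m !))) z≤n
  commonClasses-bound zero Cs ∣Cs∣≡ℓ Cs! F  distinct common =
    ≤-trans (≤-reflexive (*-identityˡ (length F)))
      (all-classes-common⇒length≤1 Cs! (trans (sym (+-identityʳ _)) ∣Cs∣≡ℓ) F distinct common)
  commonClasses-bound {n = n} (suc m) Cs ∣Cs∣+1+m≡ℓ Cs! F@(P ∷ _) distinct common = begin
    suc m ! * length F
      ≡⟨ regroup (suc m) (m !) (length F) ⟩
    m ! * (length F * suc m)
      ≤⟨ double-counting _∋?_ (m !) (All.tabulate further≥1+m) (All.tabulate through-≤) ⟩
    length candidates * prodBinomFrom n k (suc (length Cs)) m
      ≡⟨ cong (_* prodBinomFrom n k (suc (length Cs)) m) length-candidates ⟩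
    prodBinomFrom n k (length Cs) (suc m) ∎
    where
    open ≤-Reasoning
    candidates : List (Subset n)
    candidates = subsetsAvoiding (⋃ Cs) k

    length-candidates : length candidates ≡ (n ∸ length Cs * k) C k
    length-candidates = trans (length-subsetsAvoiding (⋃ Cs) k)
      (cong (λ u → (n ∸ u) C k) (⊆classes⇒∣⋃∣ P Cs! (common⇒⊆classes common (here refl))))

    regroup : ∀ a b c → a * b * c ≡ b * (c * a)
    regroup = solve-∀

    further≥1+m : ∀ {Q} → Q ∈ F → suc m ≤ degree _∋?_ candidates Q
    further≥1+m {Q} Q∈F = +-cancelˡ-≤ (length Cs) _ _
      (≤-trans (≤-reflexive ∣Cs∣+1+m≡ℓ) (ℓ≤length+degree Q Cs (common⇒⊆classes common Q∈F)))

    through-≤ : ∀ {A} → A ∈ candidates →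
      m ! * length (through A F) ≤ prodBinomFrom n k (suc (length Cs)) m
    through-≤ {A} A∈ with ∣A∣≡k , A#⋃Cs ← All.lookup (all-subsetsAvoiding (⋃ Cs) k) A∈ =
      commonClasses-bound m (A ∷ Cs) (trans (sym (+-suc (length Cs) m)) ∣Cs∣+1+m≡ℓ)
        (All.¬Any⇒All¬ Cs (disjoint-⋃⇒∉ (size⇒Nonempty ∣A∣≡k) A#⋃Cs) ∷ Cs!)
        (through A F) (AllPairs.filter⁺ (_∋? A) distinct) (through-common A F common)

Canonical : Subset n → List (SubPartition n k ℓ) → Set
Canonical {k = k} S F = ∣ S ∣ ≡ k × (∀ Q → S ∈ classes Q ⇔ Any (SameClasses Q) F)

sameClasses? : (P Q : SubPartition n k ℓ) → Dec (SameClasses P Q)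
sameClasses? P Q = included? P Q ×-dec included? Q P
  where
  included? : (P Q : SubPartition n k ℓ) → Dec (∀ c → c ∈ classes P → c ∈ classes Q)
  included? P Q =
    map′ (λ (P⊆Q : classes P ⊆ classes Q) _ → P⊆Q) (λ P⊆Q → P⊆Q _) (classes P ⊆? classes Q)

module _ .{{_ : NonZero k}} where

  star-bound : ∀ {m S} (F : List (SubPartition n k (1 + m))) → Distinct F → CommonClass F S →
    m ! * length F ≤ prodBinom n k m
  star-bound {n = n} {m} {S} F distinct star =
    subst (m ! * length F ≤_) (sym (prodBinom≡prodBinomFrom-1 n k m))
      (commonClasses-bound m [ S ] refl ([] ∷ []) F distinct (star ∷ []))

  -- If Q ∋ S were missing from F, the star Q ∷ F would violate star-bound.
  star-attaining-bound⇒complete : ∀ {m S} (F : List (SubPartition n k (1 + m))) →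
    Distinct F → CommonClass F S →
    m ! * length F ≡ prodBinom n k m → ∀ Q → S ∈ classes Q → Any (SameClasses Q) F
  star-attaining-bound⇒complete {m = m} F distinct star attained Q S∈Q
    with Any.any? (sameClasses? Q) F
  ... | yes Q∈F = Q∈F
  ... | no  Q∉F = contradiction
    (star-bound (Q ∷ F) (All.¬Any⇒All¬ F Q∉F ∷ distinct) (S∈Q ∷ star))
    (<⇒≱ (subst (_< m ! * length (Q ∷ F)) attained (*-monoʳ-< (m !) {{m !≢0}} ≤-refl)))

  star-attaining-bound⇒canonical : ∀ {m S} → k * (1 + m) ≤ n →
    (F : List (SubPartition n k (1 + m))) → Distinct F → CommonClass F S →
    m ! * length F ≡ prodBinom n k m → Canonical S F
  star-attaining-bound⇒canonical {n = n} {m} kℓ≤n [] _ _ attained = contradiction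
    (trans (sym (*-zeroʳ (m !))) (trans attained (prodBinom≡prodBinomFrom-1 n k m)))
    (<⇒≢ (0<prodBinomFrom 1 m kℓ≤n))
  star-attaining-bound⇒canonical {S = S} _ F@(P ∷ _) distinct star attained =
      class-size P (All.head star)
    , λ Q → mk⇔ (star-attaining-bound⇒complete F distinct star attained Q) (S∈classes Q)
    where
    S∈classes : ∀ Q → Any (SameClasses Q) F → S ∈ classes Q
    S∈classes Q Q∈F = let R , R∈F , _ , R⊆Q = find Q∈F in R⊆Q S (All.lookup star R∈F)

-- Nontrivial intersecting families

Nontrivial : List (SubPartition n k ℓ) → Set
Nontrivial F = ∀ A → Any (λ P → A ∉ classes P) F

commonClass⊎nontrivial : (F : List (SubPartition n k ℓ)) → ∃ (CommonClass F) ⊎ Nontrivial F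
commonClass⊎nontrivial []         = inj₁ (⊥ , [])
commonClass⊎nontrivial F@(P₀ ∷ _) with Any.any? (λ A → All.all? (_∋? A) F) (classes P₀)
... | yes common  = inj₁ (Product.map₂ proj₂ (find common))
... | no  ¬common = inj₂ λ A → All.¬All⇒Any¬ (_∋? A) F (λ A∈F → ¬common (lose (All.head A∈F) A∈F))

intersecting-bound : ∀ c {b} {F : List (SubPartition n k ℓ)} (Q : SubPartition n k ℓ) →
  All (λ P → Intersecting P Q) F →
  (∀ {A} → A ∈ classes Q → c * length (through A F) ≤ b) → c * length F ≤ ℓ * b
intersecting-bound c {b} {F} Q F∩Q c*through≤b = subst (λ l → c * length F ≤ l * b) (len Q)
  (covering-bound _∋?_ c (All.map (λ (A , A∈P , A∈Q) → lose A∈Q A∈P) F∩Q) (All.tabulate c*through≤b))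

nontrivial-bound : ∀ {m} .{{_ : NonZero k}} (F : List (SubPartition n k (2 + m))) →
  Distinct F → IntersectingFamily F → Nontrivial F →
  m ! * length F ≤ (2 + m) * ((2 + m) * prodBinomFrom n k 2 m)
nontrivial-bound {k = k} {n = n} {m} F distinct intersecting nontrivial
  with P₀ , P₀∈F , _ ← find (nontrivial ⊥) =
  intersecting-bound (m !) P₀ (allIntersecting P₀∈F) through-one
  where
  allIntersecting : ∀ {Q} → Q ∈ F → All (λ P → Intersecting P Q) F
  allIntersecting Q∈F = All.tabulate λ P∈F → intersecting _ _ P∈F Q∈F

  through-two : ∀ {A B} → B ≢ A → m ! * length (through B (through A F)) ≤ prodBinomFrom n k 2 m
  through-two {A} {B} B≢A = commonClasses-bound m (B ∷ A ∷ []) refl ((B≢A ∷ []) ∷ [] ∷ [])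
    (through B (through A F)) (AllPairs.filter⁺ (_∋? B) (AllPairs.filter⁺ (_∋? A) distinct))
    (through-common B (through A F) (through-common A F []))

  through-one : ∀ {A} → A ∈ classes P₀ →
    m ! * length (through A F) ≤ (2 + m) * prodBinomFrom n k 2 m
  through-one {A} _ with Q , Q∈F , A∉Q ← find (nontrivial A) =
    intersecting-bound (m !) Q (All.filter⁺ (_∋? A) (allIntersecting Q∈F))
      λ B∈Q → through-two λ { refl → A∉Q B∈Q }

nontrivial⇒3*k≤n : .{{_ : NonZero k}} {F : List (SubPartition n k 2)} →
  IntersectingFamily F → Nontrivial F → 3 * k ≤ n
nontrivial⇒3*k≤n intersecting nontrivial
  with P@record { classes = A ∷ B ∷ [] } , P∈F , _ ← find (nontrivial ⊥)
  with Q , Q∈F , A∉Q ← find (nontrivial A)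
  with R , R∈F , B∉R ← find (nontrivial B)
  with intersecting P Q P∈F Q∈F | intersecting P R P∈F R∈F | intersecting Q R Q∈F R∈F
... | _ , here refl         , A∈Q | _                           | _ = contradiction A∈Q A∉Q
... | _                           | _ , there (here refl) , B∈R | _ = contradiction B∈R B∉R
... | _ , there (here refl) , B∈Q | _ , here refl         , A∈R | D , D∈Q , D∈R =
  disjoint⇒length*k≤n pairwise (class-size R A∈R ∷ class-size Q B∈Q ∷ class-size Q D∈Q ∷ [])
  where
  pairwise : AllPairs Disjoint (A ∷ B ∷ D ∷ [])
  pairwise = ( All.head (AllPairs.head (disj P))
             ∷ class-disjoint R A∈R D∈R (λ { refl → A∉Q D∈Q }) ∷ [])
           ∷ (class-disjoint Q B∈Q D∈Q (λ { refl → B∉R D∈R }) ∷ [])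
           ∷ [] ∷ []

nontrivial⇒[1+m]*[2+m]²<C : ∀ m {F : List (SubPartition n k (2 + m))} → 3 ≤ k → k * (2 + m) ≤ n →
  IntersectingFamily F → Nontrivial F → (1 + m) * ((2 + m) * (2 + m)) < (n ∸ 1 * k) C k
-- For ℓ = 2 the general inequality with m = 2, available since 3k ≤ n, gives 4 < 18 < C(n - k, k).
nontrivial⇒[1+m]*[2+m]²<C {n = n} {k = k@(suc _)} zero 3≤k _ intersecting nontrivial =
  <-trans (m≤m+n 5 13) (m*[1+m]²<nCk {2} ≤-refl 3≤k (k*[j+m]≤n⇒k*m≤n∸j*k k 1
    (subst (_≤ n) (*-comm 3 k) (nontrivial⇒3*k≤n intersecting nontrivial))))
nontrivial⇒[1+m]*[2+m]²<C {k = k} (suc m) 3≤k kℓ≤n _ _ =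
  m*[1+m]²<nCk (s≤s (s≤s z≤n)) 3≤k (k*[j+m]≤n⇒k*m≤n∸j*k k 1 kℓ≤n)

nontrivial-strict-bound : ∀ m (F : List (SubPartition n k (2 + m))) → 3 ≤ k → k * (2 + m) ≤ n →
  Distinct F → IntersectingFamily F → Nontrivial F → (1 + m) ! * length F < prodBinom n k (1 + m)
nontrivial-strict-bound {n} {k@(suc _)} m F 3≤k kℓ≤n distinct intersecting nontrivial = begin-strict
  (1 + m) * m ! * length F
    ≡⟨ *-assoc (1 + m) (m !) (length F) ⟩
  (1 + m) * (m ! * length F)
    ≤⟨ *-monoʳ-≤ (1 + m) (nontrivial-bound F distinct intersecting nontrivial) ⟩
  (1 + m) * ((2 + m) * ((2 + m) * through-two))
    ≡⟨ regroup (1 + m) (2 + m) through-two ⟩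
  (1 + m) * ((2 + m) * (2 + m)) * through-two
    <⟨ *-monoˡ-< through-two {{>-nonZero (0<prodBinomFrom 2 m kℓ≤n)}}
         (nontrivial⇒[1+m]*[2+m]²<C m 3≤k kℓ≤n intersecting nontrivial) ⟩
  prodBinomFrom n k 1 (1 + m)
    ≡⟨ prodBinom≡prodBinomFrom-1 n k (1 + m) ⟨
  prodBinom n k (1 + m) ∎
  where
  open ≤-Reasoning
  through-two : ℕ
  through-two = prodBinomFrom n k 2 m

  regroup : ∀ a b c → a * (b * (b * c)) ≡ a * (b * b) * c
  regroup = solve-∀

theorem1 : (n k ℓ : ℕ) → 1 ≤ n → 2 ≤ ℓ → 3 ≤ k → k * ℓ ≤ n →
    (F : List (SubPartition n k ℓ)) → Distinct F → IntersectingFamily F →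
    ((ℓ ∸ 1) ! * length F ≤ prodBinom n k (ℓ ∸ 1))
    × ((ℓ ∸ 1) ! * length F ≡ prodBinom n k (ℓ ∸ 1) →
       ∃ λ (S : Subset n) → ∣ S ∣ ≡ k ×
         ((Q : SubPartition n k ℓ) → (S ∈ classes Q ⇔ Any (SameClasses Q) F)))
theorem1 n k         1             _ (s≤s ())
theorem1 n k@(suc _) (suc (suc m)) _ _ 3≤k kℓ≤n F distinct intersecting with commonClass⊎nontrivial F
... | inj₁ (S , star)  =
    star-bound F distinct star
  , λ attained → S , star-attaining-bound⇒canonical kℓ≤n F distinct star attained
... | inj₂ nontrivial = <⇒≤ strict , λ attained → contradiction attained (<⇒≢ strict)
  where
  strict : suc m ! * length F < prodBinom n k (suc m)
  strict = nontrivial-strict-bound m F 3≤k kℓ≤n distinct intersecting nontrivial
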